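{- In Morpion Solitaire 5D, starting from the standard initial configuration, the number of moves in any play cannot exceed $121$.
   Context: Morpion Solitaire 5D is a one-player game on the integer lattice $\mathbb{Z}^2$. Initially there are 36 crosses, placed on the lattice points lying on the boundary of the 12-sided polygon (a "Greek cross") with consecutive vertices $(3,0),(6,0),(6,3),(9,3),(9,6),(6,6),(6,9),(3,9),(3,6),(0,6),(0,3),(3,3)$; each of its 12 edges contains exactly 4 lattice points. A move consists of: (1) placing a new cross on a lattice point that currently has no cross; (2) drawing a line, i.e. a segment covering exactly 5 consecutive lattice points in one of the four directions (horizontal, vertical, or one of the two diagonals), such that all 5 covered points carry crosses and one of them is the cross placed in step (1). In the 5D variant, a newly drawn line may not share any lattice point with a previously drawn line of the same direction. The game is a sequence of legal moves; its score is the number of moves. -}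

module Defs where

open import Data.Nat using (ℕ; zero; suc)
open import Data.Integer using (ℤ; +_; -[1+_]; _+_)
open import Data.Product using (_×_; _,_)
open import Data.List using (List; []; _∷_; map; _++_; concatMap)
open import Data.List.Membership.Propositional using (_∈_; _∉_)
open import Data.List.Relation.Unary.All using (All)
open import Relation.Binary.PropositionalEquality using (_≡_)

Point : Set
Point = ℤ × ℤ

data Dir : Set where
  horiz vert diag antidiag : Dir

step : Dir → Point
step horiz    = (+ 1 , + 0)
step vert     = (+ 0 , + 1)
step diag     = (+ 1 , + 1)
step antidiag = (+ 1 , -[1+ 0 ])

_⊕_ : Point → Point → Point
(a , b) ⊕ (c , d) = (a + c , b + d)

record Line : Set where
  constructor line
  field
    start : Point
    dir   : Dir
open Line public

linePoints : Line → List Point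
linePoints (line p d) = p ∷ p1 ∷ p2 ∷ p3 ∷ p4 ∷ []
  where
  s  = step d
  p1 = p ⊕ s
  p2 = p1 ⊕ s
  p3 = p2 ⊕ s
  p4 = p3 ⊕ s

edge : Point → Point → List Point
edge a u = a ∷ (a ⊕ u) ∷ ((a ⊕ u) ⊕ u) ∷ (((a ⊕ u) ⊕ u) ⊕ u) ∷ []

pt : ℕ → ℕ → Point
pt x y = (+ x , + y)

E N W S : Point
E = (+ 1 , + 0)
N = (+ 0 , + 1)
W = (-[1+ 0 ] , + 0)
S = (+ 0 , -[1+ 0 ])

-- The 36 initial crosses: lattice points on the boundary of the Greek cross
-- with consecutive vertices (3,0),(6,0),(6,3),(9,3),(9,6),(6,6),(6,9),(3,9),
-- (3,6),(0,6),(0,3),(3,3); each edge is listed by its start vertex and unit step.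
initial : List Point
initial =
     edge (pt 3 0) E
  ++ edge (pt 6 0) N
  ++ edge (pt 6 3) E
  ++ edge (pt 9 3) N
  ++ edge (pt 9 6) W
  ++ edge (pt 6 6) N
  ++ edge (pt 6 9) W
  ++ edge (pt 3 9) S
  ++ edge (pt 3 6) W
  ++ edge (pt 0 6) S
  ++ edge (pt 0 3) E
  ++ edge (pt 3 3) S

Disjoint : Line → Line → Set
Disjoint l l' = ∀ x → x ∈ linePoints l → x ∉ linePoints l'

Compatible5D : Line → Line → Set
Compatible5D l l' = dir l ≡ dir l' → Disjoint l l'

data Reachable : List Point → List Line → ℕ → Set where
  init  : Reachable initial [] 0
  move  : ∀ {C L n} → Reachable C L n →
          (q : Point) (l : Line) →
          q ∉ C →
          q ∈ linePoints l →
          All (λ x → x ∈ (q ∷ C)) (linePoints l) →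
          All (Compatible5D l) L →
          Reachable (q ∷ C) (l ∷ L) (suc n)

{-# OPTIONS --safe #-}

-- Suppose 122 moves were played, so that there are 158 crosses.  For two
-- directions a and b, split the crosses into 25 cells c i j by the residues mod 5
-- of two linear forms, the first constant on a-lines, the second on b-lines.
-- Each a-line with first residue i has exactly one point in every cell c i j, so
-- the number α i of such lines satisfies α i ≤ c i j for all j; likewise
-- β j ≤ c i j for the b-lines.  Hence 5 Σα ≤ 158, that is, Σα ≤ 31.  But
-- Σα = Σβ = 31 is impossible: 31 is not a multiple of 5, so r rows have α i ≥ 7
-- and k columns have β j ≥ 7 with 0 < r, k < 5; counting the excess over α and over
-- β gives (5 − r) k ≤ 3 and (5 − k) r ≤ 3, whereas their sum is at least 8.  So at
-- most one direction has 31 lines and the others at most 30: only 121 in total.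

module Submission where

open import Defs
open import Data.Bool using (if_then_else_)
open import Data.Nat using (ℕ; zero; suc; _+_; _*_; _∸_; _≤_; _≤?_; z≤n; s≤s)
open import Data.Nat.DivMod using (_mod_)
open import Data.Nat.Properties hiding (_≟_)
open import Data.Nat.Tactic.RingSolver using (solve-∀)
open import Data.Integer as ℤ using (ℤ; +_; -[1+_])
import Data.Integer.Properties as ℤₚ
open import Data.Fin using (Fin; zero; suc; toℕ; punchIn)
open import Data.Fin.Patterns
open import Data.Fin.Properties using (_≟_; all?; ¬∀⟶∃¬; punchInᵢ≢i)
open import Data.Product using (_×_; _,_; proj₁; proj₂)
import Data.Product.Properties as ×
open import Data.Sum using (_⊎_; inj₁; inj₂; [_,_]′)
open import Data.List using (List; []; _∷_; _++_; length; map; filter; deduplicate)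
open import Data.List.Properties using (length-++)
open import Data.List.Membership.Propositional using (_∈_; lose; find)
open import Data.List.Membership.Propositional.Properties
  using (∈-∃++; ∈-++⁻; ∈-++⁺ˡ; ∈-++⁺ʳ; ∈-filter⁺; ∈-deduplicate⁺)
open import Data.List.Relation.Unary.All as All using (All; []; _∷_)
import Data.List.Relation.Unary.All.Properties as All
open import Data.List.Relation.Unary.Any as Any using (Any; here; there)
import Data.List.Relation.Unary.Any.Properties as Any
open import Data.List.Relation.Unary.AllPairs using (AllPairs; []; _∷_)
import Data.List.Relation.Unary.AllPairs.Properties as AllPairs
open import Algebra.Properties.Semiring.Sum +-*-semiring
open import Function using (_∘_)
open import Relation.Nullary using (¬_; does; yes; no; contradiction)
open import Relation.Nullary.Decidable using (from-yes; _×-dec_; _→-dec_; ¬?)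
open import Relation.Binary.PropositionalEquality

-- Finite sums

∑-mono-≤ : ∀ {n} {f g : Fin n → ℕ} → (∀ i → f i ≤ g i) → sum f ≤ sum g
∑-mono-≤ {zero}  f≤g = z≤n
∑-mono-≤ {suc n} f≤g = +-mono-≤ (f≤g zero) (∑-mono-≤ (f≤g ∘ suc))

term≤∑ : ∀ {n} (f : Fin n → ℕ) i → f i ≤ sum f
term≤∑ f zero    = m≤m+n _ _
term≤∑ f (suc i) = ≤-trans (term≤∑ (f ∘ suc) i) (m≤n+m _ _)

δ : ∀ {n} → Fin n → Fin n → ℕ
δ i j = if does (i ≟ j) then 1 else 0

∑-δ : ∀ {n} (i : Fin n) → sum (δ i) ≡ 1
∑-δ {suc n} zero    = cong suc (sum-replicate-zero n)
∑-δ {suc n} (suc i) = ∑-δ i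

module _ {A : Set} {m : ℕ} (f : A → Fin m) where

  fibre : Fin m → List A → List A
  fibre i = filter (λ x → f x ≟ i)

  length-fibre-∷ : ∀ x xs i → length (fibre i (x ∷ xs)) ≡ δ (f x) i + length (fibre i xs)
  length-fibre-∷ x xs i with f x ≟ i
  ... | yes _ = refl
  ... | no  _ = refl

  ∑-fibres : ∀ xs → ∑[ i < m ] length (fibre i xs) ≡ length xs
  ∑-fibres []       = sum-replicate-zero m
  ∑-fibres (x ∷ xs) = begin
    ∑[ i < m ] length (fibre i (x ∷ xs))             ≡⟨ sum-cong-≗ (length-fibre-∷ x xs) ⟩
    ∑[ i < m ] (δ (f x) i + length (fibre i xs))     ≡⟨ ∑-distrib-+ (δ (f x)) (λ i → length (fibre i xs)) ⟩
    sum (δ (f x)) + ∑[ i < m ] length (fibre i xs)   ≡⟨ cong₂ _+_ (∑-δ (f x)) (∑-fibres xs) ⟩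
    suc (length xs)                                  ∎
    where open ≡-Reasoning

-- At most one value can exceed `b`: once `f zero` does, pairing it with each later index bounds all
-- the others. This adds up the line counts of the four directions.
∑-pairwise-≤ : ∀ {n b} (f : Fin n → ℕ) → (∀ i → f i ≤ suc b) →
               (∀ i j → i ≢ j → f i ≤ b ⊎ f j ≤ b) → sum f ≤ suc (n * b)
∑-pairwise-≤ {zero}      f f≤1+b pair = z≤n
∑-pairwise-≤ {suc n} {b} f f≤1+b pair with f zero ≤? b
... | yes f₀≤b = ≤-trans
  (+-mono-≤ f₀≤b (∑-pairwise-≤ (f ∘ suc) (f≤1+b ∘ suc)
    (λ i j i≢j → pair (suc i) (suc j) λ { refl → i≢j refl })))
  (≤-reflexive (+-suc b (n * b)))
... | no f₀≰b = +-mono-≤ (f≤1+b zero)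
  (≤-trans (∑-mono-≤ λ i → [ (λ f₀≤b → contradiction f₀≤b f₀≰b) , (λ fᵢ≤b → fᵢ≤b) ]′ (pair zero (suc i) λ ()))
           (≤-reflexive (∑-const n)))
  where
  ∑-const : ∀ n → ∑[ _ < n ] b ≡ n * b
  ∑-const zero    = refl
  ∑-const (suc n) = cong₂ _+_ refl (∑-const n)

-- Row and column bounds on a 5 × 5 table

-- Indicators of `x ≤ 6` and `x ≥ 7`. The threshold fits a sum of 31 = 5 · 6 + 1 over five rows:
-- some value is then high and some value low.
low high : ℕ → ℕ
low x with x ≤? 6
... | yes _ = 1
... | no  _ = 0
high x with x ≤? 6
... | yes _ = 0
... | no  _ = 1

low+high≡1 : ∀ x → low x + high x ≡ 1
low+high≡1 x with x ≤? 6
... | yes _ = refl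
... | no  _ = refl

∑low+∑high≡5 : (α : Fin 5 → ℕ) → sum (low ∘ α) + sum (high ∘ α) ≡ 5
∑low+∑high≡5 α = trans (sym (∑-distrib-+ (low ∘ α) (high ∘ α))) (sum-cong-≗ (low+high≡1 ∘ α))

high≡1 : ∀ {x} → ¬ x ≤ 6 → high x ≡ 1
high≡1 {x} x≰6 with x ≤? 6
... | yes x≤6 = contradiction x≤6 x≰6
... | no  _   = refl

low≡1 : ∀ {x} → ¬ 7 ≤ x → low x ≡ 1
low≡1 {x} 7≰x with x ≤? 6
... | yes _   = refl
... | no  x≰6 = contradiction (≰⇒> x≰6) 7≰x

∑high≥1 : (α : Fin 5 → ℕ) → 31 ≤ sum α → 1 ≤ sum (high ∘ α)
∑high≥1 α 31≤∑α
  with i , αᵢ≰6 ← ¬∀⟶∃¬ 5 _ (λ i → α i ≤? 6) (λ α≤6 → <⇒≱ 31≤∑α (∑-mono-≤ α≤6))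
  = subst (_≤ sum (high ∘ α)) (high≡1 αᵢ≰6) (term≤∑ (high ∘ α) i)

∑low≥1 : (α : Fin 5 → ℕ) → sum α ≤ 31 → 1 ≤ sum (low ∘ α)
∑low≥1 α ∑α≤31
  with i , 7≰αᵢ ← ¬∀⟶∃¬ 5 _ (λ i → 7 ≤? α i)
                    -- `m≤m+n 32 3` is 32 ≤ 35 = 5 · 7.
                    (λ 7≤α → <⇒≱ (s≤s ∑α≤31) (≤-trans (m≤m+n 32 3) (∑-mono-≤ 7≤α)))
  = subst (_≤ sum (low ∘ α)) (low≡1 7≰αᵢ) (term≤∑ (low ∘ α) i)

-- The product is 1 only when `x ≤ 6 < y ≤ z`, and then `z` is at least `x + 1`.
cell-bound : ∀ {x y z} → x ≤ z → y ≤ z → x + low x * high y ≤ z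
cell-bound {x} {y} x≤z y≤z with x ≤? 6 | y ≤? 6
... | yes _   | yes _   = ≤-trans (≤-reflexive (+-identityʳ x)) x≤z
... | yes x≤6 | no  y≰6 = ≤-trans (+-monoˡ-≤ 1 x≤6) (≤-trans (≰⇒> y≰6) y≤z)
... | no  _   | _       = ≤-trans (≤-reflexive (+-identityʳ x)) x≤z

-- `cell-bound` summed over the 25 cells: in a low row and a high column, `c i j` exceeds `α i` by
-- at least one, and the product of the two counts is the number of such cells.
table-bound : (α β : Fin 5 → ℕ) (c : Fin 5 → Fin 5 → ℕ) →
              (∀ i j → α i ≤ c i j) → (∀ i j → β j ≤ c i j) →
              5 * sum α + sum (low ∘ α) * sum (high ∘ β) ≤ ∑[ i < 5 ] ∑[ j < 5 ] c i j
table-bound α β c α≤c β≤c = begin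
  5 * sum α + sum (low ∘ α) * H                              ≡⟨ cong₂ _+_ (*-distribˡ-sum 5 α) (*-distribʳ-sum H (low ∘ α)) ⟩
  ∑[ i < 5 ] (5 * α i) + ∑[ i < 5 ] (low (α i) * H)          ≡⟨ ∑-distrib-+ (λ i → 5 * α i) (λ i → low (α i) * H) ⟨
  ∑[ i < 5 ] (5 * α i + low (α i) * H)                       ≡⟨ sum-cong-≗ row ⟩
  ∑[ i < 5 ] ∑[ j < 5 ] (α i + low (α i) * high (β j))       ≤⟨ ∑-mono-≤ (λ i → ∑-mono-≤ λ j → cell-bound (α≤c i j) (β≤c i j)) ⟩
  ∑[ i < 5 ] ∑[ j < 5 ] c i j                                ∎
  where
  open ≤-Reasoning
  H = sum (high ∘ β)
  row : ∀ i → 5 * α i + low (α i) * H ≡ ∑[ j < 5 ] (α i + low (α i) * high (β j))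
  row i = trans (cong₂ _+_ refl (*-distribˡ-sum (low (α i)) (high ∘ β)))
                (sym (∑-distrib-+ (λ _ → α i) (λ j → low (α i) * high (β j))))

∑row≤31 : ∀ x y → 5 * x + y ≤ 158 → x ≤ 31
∑row≤31 x y 5x+y≤158 =
  -- 158 < 160 = 5 · 32.
  ≤-pred (*-cancelˡ-< 5 x 32 (≤-trans (s≤s (≤-trans (m≤m+n (5 * x) y) 5x+y≤158)) (m≤m+n 159 1)))

excess≤3 : ∀ x y → 31 ≤ x → 5 * x + y ≤ 158 → y ≤ 3
excess≤3 x y 31≤x 5x+y≤158 =
  -- 5 · 31 = 155 leaves 3 of the 158.
  +-cancelˡ-≤ 155 y 3 (≤-trans (+-monoˡ-≤ y (*-monoʳ-≤ 5 31≤x)) 5x+y≤158)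

-- Writing the four counts as successors, the two products add up to 8 plus
-- a sum of products.
counts-incompatible : ∀ l h l′ h′ → 1 ≤ l → 1 ≤ h → 1 ≤ l′ → 1 ≤ h′ →
                      l + h ≡ 5 → l′ + h′ ≡ 5 → l * h′ ≤ 3 → ¬ l′ * h ≤ 3
counts-incompatible (suc l) (suc h) (suc l′) (suc h′) _ _ _ _ l+h l′+h′ p q =
  <⇒≱ (m≤m+n 7 1) (begin
    8                                                       ≤⟨ m≤m+n 8 (l * h′ + l′ * h) ⟩
    5 + 5 ∸ 2 + (l * h′ + l′ * h)                           ≡⟨ cong₂ (λ s t → s + t ∸ 2 + (l * h′ + l′ * h)) (sym l+h) (sym l′+h′) ⟩
    (suc l + suc h + (suc l′ + suc h′) ∸ 2) + (l * h′ + l′ * h)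
      ≡⟨ cong (λ s → s ∸ 2 + (l * h′ + l′ * h)) (two-out l h l′ h′) ⟩
    2 + (l + h + (l′ + h′)) + (l * h′ + l′ * h)             ≡⟨ expand l h l′ h′ ⟨
    suc l * suc h′ + suc l′ * suc h                         ≤⟨ +-mono-≤ p q ⟩
    6                                                       ∎)
  where
  open ≤-Reasoning
  two-out : ∀ l h l′ h′ → suc l + suc h + (suc l′ + suc h′) ≡ 4 + (l + h + (l′ + h′))
  two-out = solve-∀
  expand : ∀ l h l′ h′ → suc l * suc h′ + suc l′ * suc h ≡ 2 + (l + h + (l′ + h′)) + (l * h′ + l′ * h)
  expand = solve-∀

table-sums : (α β : Fin 5 → ℕ) (c : Fin 5 → Fin 5 → ℕ) →
             (∀ i j → α i ≤ c i j) → (∀ i j → β j ≤ c i j) →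
             ∑[ i < 5 ] ∑[ j < 5 ] c i j ≤ 158 →
             sum α ≤ 31 × (sum α ≤ 30 ⊎ sum β ≤ 30)
table-sums α β c α≤c β≤c ∑c≤158 = ∑α≤31 , either
  where
  rows : 5 * sum α + sum (low ∘ α) * sum (high ∘ β) ≤ 158
  rows = ≤-trans (table-bound α β c α≤c β≤c) ∑c≤158
  columns : 5 * sum β + sum (low ∘ β) * sum (high ∘ α) ≤ 158
  -- Transposing the table keeps its total and exchanges the roles of `α` and `β`.
  columns = ≤-trans (table-bound β α (λ j i → c i j) (λ j i → β≤c i j) (λ j i → α≤c i j))
                    (≤-trans (≤-reflexive (sym (∑-comm c))) ∑c≤158)
  ∑α≤31 = ∑row≤31 (sum α) _ rows
  ∑β≤31 = ∑row≤31 (sum β) _ columns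
  either : sum α ≤ 30 ⊎ sum β ≤ 30
  either with sum α ≤? 30 | sum β ≤? 30
  ... | yes ∑α≤30 | _         = inj₁ ∑α≤30
  ... | no  _     | yes ∑β≤30 = inj₂ ∑β≤30
  -- Both sums would be 31, so each of the two excess products would be at most 3.
  ... | no  ∑α≰30 | no  ∑β≰30 = contradiction
    (excess≤3 (sum β) _ (≰⇒> ∑β≰30) columns)
    (counts-incompatible (sum (low ∘ α)) (sum (high ∘ α)) (sum (low ∘ β)) (sum (high ∘ β))
      (∑low≥1 α ∑α≤31) (∑high≥1 α (≰⇒> ∑α≰30))
      (∑low≥1 β ∑β≤31) (∑high≥1 β (≰⇒> ∑β≰30))
      (∑low+∑high≡5 α) (∑low+∑high≡5 β)
      (excess≤3 (sum α) _ (≰⇒> ∑α≰30) rows))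

-- Points modulo 5

next prev : Fin 5 → Fin 5
next i = (toℕ i + 1) mod 5
prev i = (toℕ i + 4) mod 5

next-prev : ∀ i → next (prev i) ≡ i
next-prev = from-yes (all? λ i → next (prev i) ≟ i)

prev-next : ∀ i → prev (next i) ≡ i
prev-next = from-yes (all? λ i → prev (next i) ≟ i)

-- Recursion by unit steps, rather than integer division, turns ±1 on integers into `next` and
-- `prev` almost by computation.
residue : ℤ → Fin 5
residue (+ zero)       = 0F
residue (+ suc n)      = next (residue (+ n))
residue -[1+ zero ]    = prev 0F
residue -[1+ suc n ]   = prev (residue -[1+ n ])

residue-+1 : ∀ z → residue (z ℤ.+ + 1) ≡ next (residue z)
residue-+1 (+ n)        = cong (residue ∘ +_) (+-comm n 1)
residue-+1 -[1+ zero ]  = refl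
residue-+1 -[1+ suc n ] = sym (next-prev _)

residue-−1 : ∀ z → residue (z ℤ.+ -[1+ 0 ]) ≡ prev (residue z)
residue-−1 (+ zero)    = refl
residue-−1 (+ suc n)   = sym (prev-next _)
residue-−1 -[1+ n ]    = cong (residue ∘ -[1+_] ∘ suc) (+-identityʳ n)

Residue : Set
Residue = Fin 5 × Fin 5

residues : Point → Residue
residues (x , y) = residue x , residue y

shift : Dir → Residue → Residue
shift horiz    (x , y) = next x , y
shift vert     (x , y) = x      , next y
shift diag     (x , y) = next x , next y
shift antidiag (x , y) = next x , prev y

residues-step : ∀ p d → residues (p ⊕ step d) ≡ shift d (residues p)
residues-step (x , y) horiz    = cong₂ _,_ (residue-+1 x) (cong residue (ℤₚ.+-identityʳ y))
residues-step (x , y) vert     = cong₂ _,_ (cong residue (ℤₚ.+-identityʳ x)) (residue-+1 y)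
residues-step (x , y) diag     = cong₂ _,_ (residue-+1 x) (residue-+1 y)
residues-step (x , y) antidiag = cong₂ _,_ (residue-+1 x) (residue-−1 y)

orbit : Dir → Residue → List Residue
orbit d r₀ = r₀ ∷ r₁ ∷ r₂ ∷ r₃ ∷ shift d r₃ ∷ []
  where
  r₁ = shift d r₀
  r₂ = shift d r₁
  r₃ = shift d r₂

residues-line : ∀ p d → map residues (linePoints (line p d)) ≡ orbit d (residues p)
residues-line p d
  rewrite residues-step (((p ⊕ step d) ⊕ step d) ⊕ step d) d
        | residues-step ((p ⊕ step d) ⊕ step d) d
        | residues-step (p ⊕ step d) d
        | residues-step p d = refl

index : Dir → Fin 4
index horiz    = 0F
index vert     = 1F
index diag     = 2F
index antidiag = 3F

direction : Fin 4 → Dir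
direction 0F = horiz
direction 1F = vert
direction 2F = diag
direction 3F = antidiag

direction-index : ∀ d → direction (index d) ≡ d
direction-index horiz    = refl
direction-index vert     = refl
direction-index diag     = refl
direction-index antidiag = refl

-- A linear form mod 5 that is constant on the lines of the given direction;
-- the third one is y − x.
form : Fin 4 → Residue → Fin 5
form 0F (x , y) = y
form 1F (x , y) = x
form 2F (x , y) = (toℕ y + 4 * toℕ x) mod 5
form 3F (x , y) = (toℕ y + toℕ x) mod 5

-- `form a` is constant along the orbit, while each step in the direction of `a` changes `form b` by
-- ±1 or ±2. This is nonzero modulo the prime 5, so the five points take all five values. The proof
-- runs through the finitely many cases.
orbit-meets-cell : ∀ a b → a ≢ b → ∀ x y j →
  Any (λ s → form a s ≡ form a (x , y) × form b s ≡ j) (orbit (direction a) (x , y))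
orbit-meets-cell = from-yes (all? λ a → all? λ b → ¬? (a ≟ b) →-dec
  (all? λ x → all? λ y → all? λ j →
    Any.any? (λ s → (form a s ≟ form a (x , y)) ×-dec (form b s ≟ j)) (orbit (direction a) (x , y))))

pointForm : Fin 4 → Point → Fin 5
pointForm a = form a ∘ residues

line-meets-cell : ∀ a b → a ≢ b → ∀ l j → index (dir l) ≡ a →
  Any (λ p → pointForm a p ≡ pointForm a (start l) × pointForm b p ≡ j) (linePoints l)
line-meets-cell _ b a≢b (line p d) j refl =
  Any.map⁻ (subst (Any _) (sym (trans (residues-line p d) (cong (λ e → orbit e (residues p)) (sym (direction-index d)))))
                  (orbit-meets-cell (index d) b a≢b _ _ j))

-- Counting lines and crosses

-- Lines of one direction are disjoint, so each claims a point of `ys` of its own; the induction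
-- deletes the point claimed by the first line.
packing : ∀ {d} (ys : List Point) {L} → AllPairs Compatible5D L →
          All (λ l → dir l ≡ d × Any (_∈ ys) (linePoints l)) L → length L ≤ length ys
packing ys []         []                     = z≤n
packing ys (l# ∷ L#) ((l≡d , hit) ∷ hits)
  with x , x∈l , x∈ys ← find hit
  with as , bs , refl ← ∈-∃++ x∈ys
  = begin
    suc _                        ≤⟨ s≤s (packing (as ++ bs) L# (All.zipWith avoid (l# , hits))) ⟩
    suc (length (as ++ bs))      ≡⟨ cong suc (length-++ as) ⟩
    suc (length as + length bs)  ≡⟨ +-suc (length as) (length bs) ⟨
    length as + length (x ∷ bs)  ≡⟨ length-++ as ⟨
    length (as ++ x ∷ bs)        ∎
  where
  open ≤-Reasoning
  avoid : ∀ {l′} → Compatible5D _ l′ × (dir l′ ≡ _ × Any (_∈ as ++ x ∷ bs) (linePoints l′)) →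
          dir l′ ≡ _ × Any (_∈ as ++ bs) (linePoints l′)
  avoid {l′} (l#l′ , l′≡d , hit′) with y , y∈l′ , y∈ys ← find hit′ = l′≡d , lose y∈l′ y∈rest
    where
    y∈rest : y ∈ as ++ bs
    y∈rest with ∈-++⁻ as y∈ys
    ... | inj₁ y∈as         = ∈-++⁺ˡ y∈as
    -- The deleted point lies on the first line, so no later parallel line contains it.
    ... | inj₂ (here refl)  = contradiction y∈l′ (l#l′ (trans l≡d (sym l′≡d)) x x∈l)
    ... | inj₂ (there y∈bs) = ∈-++⁺ʳ as y∈bs

-- The list initial repeats the vertices of the cross, so it has 48 entries
-- for 36 points.
crosses : ∀ {C L n} → Reachable C L n → List Point
crosses init                       = deduplicate (×.≡-dec ℤₚ._≟_ ℤₚ._≟_) initial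
crosses (move {C = C} r q _ _ _ _ _) = q ∷ crosses r

∈-crosses : ∀ {C L n} (r : Reachable C L n) {x} → x ∈ C → x ∈ crosses r
∈-crosses init                   x∈C         = ∈-deduplicate⁺ (×.≡-dec ℤₚ._≟_ ℤₚ._≟_) x∈C
∈-crosses (move r _ _ _ _ _ _) (here x≡q)  = here x≡q
∈-crosses (move r _ _ _ _ _ _) (there x∈C) = there (∈-crosses r x∈C)

length-crosses : ∀ {C L n} (r : Reachable C L n) → length (crosses r) ≡ 36 + n
length-crosses init                           = refl
length-crosses (move {n = n} r _ _ _ _ _ _) = cong suc (length-crosses r)

length-lines : ∀ {C L n} → Reachable C L n → length L ≡ n
length-lines init                   = refl
length-lines (move r _ _ _ _ _ _) = cong suc (length-lines r)

lines-compatible : ∀ {C L n} → Reachable C L n → AllPairs Compatible5D L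
lines-compatible init                      = []
lines-compatible (move r _ _ _ _ _ l#L) = l#L ∷ lines-compatible r

lines-crossed : ∀ {C L n} → Reachable C L n → All (λ l → All (_∈ C) (linePoints l)) L
lines-crossed init                      = []
lines-crossed (move r _ _ _ _ l⊆C _) = l⊆C ∷ All.map (All.map there) (lines-crossed r)

module _ {C L n} (r : Reachable C L n) where

  linesOf : Fin 4 → List Line
  linesOf a = fibre (index ∘ dir) a L

  lineCount : Fin 4 → Fin 5 → ℕ
  lineCount a i = length (fibre (pointForm a ∘ start) i (linesOf a))

  cell : Fin 4 → Fin 4 → Fin 5 → Fin 5 → List Point
  cell a b i j = fibre (pointForm b) j (fibre (pointForm a) i (crosses r))

  ∑-lineCount : ∀ a → sum (lineCount a) ≡ length (linesOf a)
  ∑-lineCount a = ∑-fibres (pointForm a ∘ start) (linesOf a)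

  ∑-cells : ∀ a b → ∑[ i < 5 ] ∑[ j < 5 ] length (cell a b i j) ≡ 36 + n
  ∑-cells a b = trans (sum-cong-≗ λ i → ∑-fibres (pointForm b) (fibre (pointForm a) i (crosses r)))
                      (trans (∑-fibres (pointForm a) (crosses r)) (length-crosses r))

  -- `ys` is left abstract because `cell` filters by `a` before `b`: the same bound then serves the
  -- rows and, with `a` and `b` exchanged, the columns.
  lineCount≤ : ∀ a b i j → a ≢ b → (ys : List Point) →
               (∀ {p} → p ∈ crosses r → pointForm a p ≡ i → pointForm b p ≡ j → p ∈ ys) →
               lineCount a i ≤ length ys
  lineCount≤ a b i j a≢b ys cell⊆ys =
    packing {direction a} ys
      (AllPairs.filter⁺ _ (AllPairs.filter⁺ _ (lines-compatible r)))
      (All.zipWith meets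
        ( All.all-filter _ (linesOf a)
        , All.filter⁺ _ (All.zip (All.all-filter _ L , All.filter⁺ _ (lines-crossed r)))))
    where
    meets : ∀ {l} → pointForm a (start l) ≡ i × (index (dir l) ≡ a × All (_∈ C) (linePoints l)) →
            dir l ≡ direction a × Any (_∈ ys) (linePoints l)
    meets {l} (form≡i , dir≡a , l⊆C) with p , p∈l , forma , formb ← find (line-meets-cell a b a≢b l j dir≡a) =
      trans (sym (direction-index (dir l))) (cong direction dir≡a) ,
      lose p∈l (cell⊆ys (∈-crosses r (All.lookup l⊆C p∈l)) (trans forma form≡i) formb)

  -- At most 122 moves give at most 36 + 122 = 158 crosses, the total that `table-sums` allows.
  linesOf-bounds : n ≤ 122 → ∀ a b → a ≢ b →
    length (linesOf a) ≤ 31 × (length (linesOf a) ≤ 30 ⊎ length (linesOf b) ≤ 30)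
  linesOf-bounds n≤122 a b a≢b =
    subst₂ (λ x y → x ≤ 31 × (x ≤ 30 ⊎ y ≤ 30)) (∑-lineCount a) (∑-lineCount b)
      (table-sums (lineCount a) (lineCount b) (λ i j → length (cell a b i j))
        (λ i j → lineCount≤ a b i j a≢b (cell a b i j)
          λ p∈C fa fb → ∈-filter⁺ _ (∈-filter⁺ _ p∈C fa) fb)
        (λ i j → lineCount≤ b a j i (a≢b ∘ sym) (cell a b i j)
          λ p∈C fb fa → ∈-filter⁺ _ (∈-filter⁺ _ p∈C fa) fb)
        (≤-trans (≤-reflexive (∑-cells a b)) (+-monoʳ-≤ 36 n≤122)))

  n≤122⇒n≤121 : n ≤ 122 → n ≤ 121
  n≤122⇒n≤121 n≤122 = begin
    n                                 ≡⟨ length-lines r ⟨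
    length L                          ≡⟨ ∑-fibres (index ∘ dir) L ⟨
    ∑[ a < 4 ] length (linesOf a)     ≤⟨ ∑-pairwise-≤ (length ∘ linesOf)
                                           -- `punchIn a 0F` is merely some direction other than
                                           -- `a`.
                                           (λ a → proj₁ (linesOf-bounds n≤122 a (punchIn a 0F) (punchInᵢ≢i a 0F ∘ sym)))
                                           (λ a b → proj₂ ∘ linesOf-bounds n≤122 a b) ⟩
    -- One direction with 31 lines and three with 30: 121 = 1 + 4 · 30.
    121                               ∎
    where open ≤-Reasoning

theorem5 : ∀ (C : List Point) (L : List Line) (n : ℕ) → Reachable C L n → n ≤ 121
theorem5 _ _ _ init                         = z≤n
-- Induction gives at most 121 moves before the last one, hence at most 122 in all; the count of
-- lines then excludes 122.
theorem5 _ _ _ r@(move r′ _ _ _ _ _ _) = n≤122⇒n≤121 r (s≤s (theorem5 _ _ _ r′))
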